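{- Let $A$ be a finite alphabet with $k=|A|$. For all $u\in A^*$ and $n\in\mathbb{N}$ there exists some $v\in A^*$ with $v\lesssim_n u$ and $|v|\leq f_k(n)$.
   Context: For words $u,v$, $u\sqsubseteq v$ (subword) means $u=a_1\cdots a_\ell$ with letters $a_i$ and $v=v_0a_1v_1\cdots a_\ell v_\ell$ for some words $v_i$. For $n\in\mathbb{N}$, $u\sim_n v$ iff $u$ and $v$ have exactly the same subwords of length at most $n$, and $u\lesssim_n v$ iff $u\sim_n v$ and $u\sqsubseteq v$. The functions $f_k:\mathbb{N}\to\mathbb{N}$ ($k\geq1$) are defined by $f_1(n)=n$ and $f_{k+1}(n)=\max_{0\leq m\leq n}\bigl(m f_k(n+1-m)+m+f_k(n-m)\bigr)$. -}

module Defs where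

open import Data.List.Base using (List; length; map; upTo)
open import Data.List.Extrema.Nat using (max)
open import Data.List.Relation.Binary.Sublist.Propositional using (_⊆_)
open import Data.Nat.Base using (ℕ; suc; _+_; _*_; _∸_; _≤_; NonZero)
open import Data.Product.Base using (_×_)
open import Function.Bundles using (_⇔_)
open import Level using (Level)

private
  variable
    a : Level
    A : Set a

infix 4 _∼[_]_ _≲[_]_

-- Words are lists, and the subword order is the sublist relation _⊆_.

_∼[_]_ : List A → ℕ → List A → Set _
u ∼[ n ] v = ∀ w → length w ≤ n → w ⊆ u ⇔ w ⊆ v

_≲[_]_ : List A → ℕ → List A → Set _
u ≲[ n ] v = u ∼[ n ] v × u ⊆ v

-- The list below is nonempty with entries in ℕ, so the default value 0
-- passed to max does not affect the maximum.  Since m ≤ n, the truncated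
-- subtractions are exact.
f : (k : ℕ) .{{_ : NonZero k}} → ℕ → ℕ
f 1               n = n
f (suc k@(suc _)) n =
  max 0 (map (λ m → m * f k (n + 1 ∸ m) + m + f k (n ∸ m)) (upTo (suc n)))

-- Cut u from the right into m ≤ n arches b ∷ p, each the shortest suffix
-- containing every letter, so that p misses the letter b; every word of length
-- at most m embeds into m arches.  With d = n ∸ m, it suffices to compress each
-- p, by induction on the alphabet, up to ∼[ suc d ], and the remaining prefix,
-- which misses a letter unless d = 0, up to ∼[ d ].  Indeed, let w be a subword
-- of length at most m + d, matched from the right.  The last arch absorbs at
-- least one letter of w.  If it absorbs at most suc d, drop it and recurse;
-- otherwise give it only the last suc d letters of w, so that fewer than m
-- letters are left for the other m ∸ 1 arches.
module Submission where

open import Level using (Level)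
open import Data.Fin.Base using (Fin)
open import Data.Fin.Properties using () renaming (_≟_ to _≟ᶠ_)
open import Data.List.Base
  using (List; []; _∷_; _++_; [_]; length; map; take; drop; allFin; initLast; _∷ʳ′_)
open import Data.List.Properties
  using (length-++; length-map; length-tabulate; length-drop; length-removeAt′;
         take++drop≡id; ++-assoc; ++-identityʳ)
open import Data.List.Extrema.Nat using (xs≤max)
open import Data.List.Membership.Propositional using (_∈_; _∉_; find)
import Data.List.Membership.DecPropositional as DecMembership
open import Data.List.Membership.Propositional.Properties using (∈-map⁺; ∈-allFin; ∈-upTo⁺)
open import Data.List.Relation.Binary.Sublist.Propositional
  using (_⊆_; []; _∷_; _∷ʳ_; ⊆-refl; ⊆-trans; minimum; from∈; to∈)
open import Data.List.Relation.Binary.Sublist.Propositional.Properties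
  using (++⁺; ++⁺ʳ; take-⊆; drop-⊆; All-resp-⊆)
open import Data.List.Relation.Unary.All as All using (All; []; _∷_)
open import Data.List.Relation.Unary.All.Properties using (¬All⇒Any¬; ++⁻) renaming (++⁺ to All-++⁺)
open import Data.List.Relation.Unary.Any using (here; there; index; _─_)
open import Data.Nat.Base using (ℕ; zero; suc; _+_; _*_; _∸_; _≤_; z≤n; s≤s; s≤s⁻¹; NonZero)
open import Data.Nat.Properties
open import Data.Nat.Tactic.RingSolver using (solve-∀)
open import Data.Product.Base using (_×_; _,_; ∃-syntax; proj₂)
open import Data.Sum.Base using (_⊎_; inj₁; inj₂)
open import Function.Bundles using (_↔_; mk⇔; module Equivalence; module Inverse)
open import Function.Properties.Inverse using (↔⇒↣)
open import Relation.Binary.Definitions using (DecidableEquality)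
open import Relation.Binary.PropositionalEquality
  using (_≡_; _≢_; refl; sym; trans; cong; subst; subst₂)
open import Relation.Nullary using (yes; no; contradiction)
open import Relation.Nullary.Decidable using (via-injection)
open import Defs

private
  variable
    a : Level
    A : Set a
    L u v w xs ys : List A
    x y : A
    n : ℕ

⊆-++-split : ∀ xs → w ⊆ xs ++ ys → ∃[ w₁ ] ∃[ w₂ ] (w ≡ w₁ ++ w₂ × w₁ ⊆ xs × w₂ ⊆ ys)
⊆-++-split []       τ = [] , _ , refl , [] , τ
⊆-++-split (x ∷ xs) (_ ∷ʳ τ) with ⊆-++-split xs τ
... | w₁ , w₂ , eq , τ₁ , τ₂ = w₁ , w₂ , eq , x ∷ʳ τ₁ , τ₂
⊆-++-split (x ∷ xs) (refl ∷ τ) with ⊆-++-split xs τ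
... | w₁ , w₂ , eq , τ₁ , τ₂ = x ∷ w₁ , w₂ , cong (x ∷_) eq , refl ∷ τ₁ , τ₂

∈-─ : (p : x ∈ xs) → y ∈ xs → y ≢ x → y ∈ (xs ─ p)
∈-─ (here refl) (here refl) y≢x = contradiction refl y≢x
∈-─ (here _)    (there q)   _   = q
∈-─ {xs = _ ∷ _ ∷ _} (there _) (here refl) _   = here refl
∈-─ {xs = _ ∷ _ ∷ _} (there p) (there q)   y≢x = there (∈-─ p q y≢x)

All-∈-─ : (p : x ∈ xs) → All (_∈ xs) u → x ∉ u → All (_∈ (xs ─ p)) u
All-∈-─ p us x∉u = All.tabulate λ y∈u →
  ∈-─ p (All.lookup us y∈u) λ { refl → x∉u y∈u }

length-∷ʳ : ∀ (xs : List A) x → length (xs ++ [ x ]) ≡ suc (length xs)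
length-∷ʳ xs x = trans (length-++ xs) (+-comm (length xs) 1)

≲-intro : v ⊆ u → (∀ w → length w ≤ n → w ⊆ u → w ⊆ v) → v ≲[ n ] u
≲-intro v⊆u keeps = (λ w le → mk⇔ (λ τ → ⊆-trans τ v⊆u) (keeps w le)) , v⊆u

≲-keeps : v ≲[ n ] u → length w ≤ n → w ⊆ u → w ⊆ v
≲-keeps (v∼u , _) le = Equivalence.from (v∼u _ le)

≲-refl : u ≲[ n ] u
≲-refl = ≲-intro ⊆-refl λ _ _ τ → τ

≲0-[] : [] ≲[ 0 ] u
≲0-[] = ≲-intro {n = 0} (minimum _) λ { [] _ _ → [] }

Universal : ℕ → List A → List A → Set _
Universal m L v = ∀ w → length w ≤ m → All (_∈ L) w → w ⊆ v

-- The alphabet is a list, so that the induction can pass to `L` with one entry deleted.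
Compressible : (ℕ → ℕ) → List A → Set _
Compressible h L = ∀ {u} → All (_∈ L) u → ∀ n → ∃[ v ] (v ≲[ n ] u × length v ≤ h n)

∷-≲ : ∀ {p q : List A} {d} → q ≲[ d ] p → x ∷ q ≲[ d ] x ∷ p
∷-≲ q≲p = ≲-intro (refl ∷ proj₂ q≲p) λ
  { w       le (_ ∷ʳ τ)   → _ ∷ʳ ≲-keeps q≲p le τ
  ; (_ ∷ w) le (refl ∷ τ) → refl ∷ ≲-keeps q≲p (≤-trans (n≤1+n _) le) τ
  }

-- A letter is a word of length 1, so the index `suc d`, being positive, ensures that a compressed
-- arch still contains every letter.
≲-letters : ∀ {p q : List A} {d} → q ≲[ suc d ] p → x ∈ p → x ∈ q
≲-letters q≲p x∈p = to∈ (≲-keeps q≲p (s≤s z≤n) (from∈ x∈p))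

-- The full block `xs` takes the last letter of `w`, and `v` takes the others.
Universal-++ : ∀ {m} → Universal m L v → All (_∈ xs) L → Universal (suc m) L (v ++ xs)
Universal-++ {xs = xs} univ full w le ws with initLast w
... | [] = minimum _
... | w′ ∷ʳ′ b with ++⁻ w′ ws
...   | ws′ , b∈L ∷ [] =
  ++⁺ (univ w′ (s≤s⁻¹ (subst (_≤ _) (length-∷ʳ w′ b) le)) ws′) (from∈ (All.lookup full b∈L))

module _ (_≟_ : DecidableEquality A) where
  open DecMembership _≟_ using (_∈?_)

  -- Read `u` from the right until no letter is missing. The alphabet is nonempty, so the empty word
  -- does miss a letter.
  missing-letter-or-last-arch : ∀ (c : A) L u →
    (∃[ b ] (b ∈ c ∷ L × b ∉ u)) ⊎
    (∃[ s ] ∃[ b ] ∃[ p ] (u ≡ s ++ b ∷ p × b ∈ c ∷ L × b ∉ p × All (_∈ b ∷ p) (c ∷ L)))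
  missing-letter-or-last-arch c L []       = inj₁ (c , here refl , λ ())
  missing-letter-or-last-arch c L (x ∷ xs) with missing-letter-or-last-arch c L xs
  ... | inj₂ (s , b , p , refl , rest) = inj₂ (x ∷ s , b , p , refl , rest)
  ... | inj₁ (b , b∈L , b∉xs) with All.all? (_∈? (x ∷ xs)) (c ∷ L)
  ...   | no ¬full = inj₁ (find (¬All⇒Any¬ (_∈? (x ∷ xs)) (c ∷ L) ¬full))
  ...   | yes full with All.lookup full b∈L
  ...     | here refl  = inj₂ ([] , x , xs , refl , b∈L , b∉xs , full)
  ...     | there b∈xs = contradiction b∈xs b∉xs

-- The arch `p` is compressed only up to `suc d`; the universality of `v` makes up for the
-- difference to `suc m + d`.
≲-++ : ∀ {m d} {s p q : List A} → All (_∈ L) s → All (_∈ L) p → All (_∈ p) L →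
       v ≲[ m + d ] s → Universal m L v → q ≲[ suc d ] p →
       v ++ q ≲[ suc m + d ] s ++ p
≲-++ {L = L} {v = v} {m} {d} {s} {p} {q} s∈L p∈L full v≲s univ q≲p =
  ≲-intro (++⁺ (proj₂ v≲s) (proj₂ q≲p)) keeps
  where
  keeps : ∀ w → length w ≤ suc m + d → w ⊆ s ++ p → w ⊆ v ++ q
  keeps w le τ with ⊆-++-split s τ
  -- If the arch absorbs nothing, the last letter of `w` is moved into it, which leaves at most
  -- `m + d` letters for `v`.
  ... | z , [] , refl , σ , ρ with initLast z
  ...   | [] = minimum _
  ...   | z′ ∷ʳ′ b = subst (_⊆ v ++ q) (sym (++-identityʳ (z′ ++ [ b ])))
    (++⁺ (≲-keeps v≲s len (⊆-trans (++⁺ʳ [ b ] ⊆-refl) σ)) (from∈ b∈q))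
    where
    len : length z′ ≤ m + d
    len = s≤s⁻¹ (subst (_≤ suc m + d)
      (trans (cong length (++-identityʳ (z′ ++ [ b ]))) (length-∷ʳ z′ b)) le)
    b∈q : b ∈ q
    b∈q with ++⁻ z′ (All-resp-⊆ σ s∈L)
    ... | _ , b∈L ∷ [] = ≲-letters q≲p (All.lookup full b∈L)
  keeps w le τ | z , y@(c ∷ y′) , refl , σ , ρ with length y ≤? suc d
  ... | yes y≤ = ++⁺ (≲-keeps v≲s len σ) (≲-keeps q≲p y≤ ρ)
    where
    len : length z ≤ m + d
    len = s≤s⁻¹ (≤-trans (m<m+n (length z) (s≤s z≤n)) (subst (_≤ suc m + d) (length-++ z) le))
  -- The arch keeps `y₂`, the last `suc d` letters of `y`. Since `suc m + d` equals `m + suc d`, at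
  -- most `m` letters remain, and `v` contains them by universality.
  ... | no y≰ = subst (_⊆ v ++ q) eq
    (++⁺ (univ (z ++ y₁) len (All-++⁺ (All-resp-⊆ σ s∈L) (All-resp-⊆ (⊆-trans (take-⊆ k y) ρ) p∈L)))
         (≲-keeps q≲p (≤-reflexive len₂) (⊆-trans (drop-⊆ k y) ρ)))
    where
    k = length y ∸ suc d
    y₁ = take k y
    y₂ = drop k y
    eq : (z ++ y₁) ++ y₂ ≡ z ++ y
    eq = trans (++-assoc z y₁ y₂) (cong (z ++_) (take++drop≡id k y))
    len₂ : length y₂ ≡ suc d
    len₂ = trans (length-drop k y) (m∸[m∸n]≡n (<⇒≤ (≰⇒> y≰)))
    len : length (z ++ y₁) ≤ m
    len = +-cancelʳ-≤ (suc d) _ _ (subst₂ _≤_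
      (trans (cong length (sym eq)) (trans (length-++ (z ++ y₁)) (cong (length (z ++ y₁) +_) len₂)))
      (sym (+-suc m d)) le)

-- The value of `d` belongs to the result, since it is known only when the cutting stops. In
-- `short`, each of the `m` arches costs one letter plus `h (suc d)`, and the prefix costs `h d`.
record ArchCompression {A : Set a} (h : ℕ → ℕ) (L u : List A) (n : ℕ) : Set a where
  field
    m d       : ℕ
    m+d≡n     : m + d ≡ n
    word      : List A
    word≲u    : word ≲[ m + d ] u
    universal : Universal m L word
    short     : length word ≤ m * h (suc d) + m + h d

module _ (_≟_ : DecidableEquality A) {h : ℕ → ℕ} {c : A} {L : List A}
         (IH : ∀ {b} (i : b ∈ c ∷ L) → Compressible h ((c ∷ L) ─ i)) where

  archCompression : ∀ n {u} → All (_∈ c ∷ L) u → ArchCompression h (c ∷ L) u n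
  -- The remaining prefix may contain every letter here, but index 0 allows the empty word.
  archCompression zero us = record
    { m = 0 ; d = 0 ; m+d≡n = refl ; word = [] ; word≲u = ≲0-[]
    ; universal = λ { [] _ _ → [] } ; short = z≤n }
  archCompression (suc n) {u} us with missing-letter-or-last-arch _≟_ c L u
  ... | inj₁ (b , i , b∉u) =
    let v , v≲u , short = IH i (All-∈-─ i us b∉u) (suc n) in record
    { m = 0 ; d = suc n ; m+d≡n = refl ; word = v ; word≲u = v≲u
    ; universal = λ { [] _ _ → minimum _ } ; short = short }
  ... | inj₂ (s , b , p , refl , i , b∉p , full) with ++⁻ s us
  ...   | ss , ps with archCompression n ss
  ...     | record { m = m ; d = d ; m+d≡n = refl ; word = v ; word≲u = v≲s
                   ; universal = univ ; short = short }
    -- The recursion on `s` comes first because it determines the index `suc d` for `p`.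
    with q , q≲p , q-short ← IH i (All-∈-─ i (All.tail ps) b∉p) (suc d) = record
    { m = suc m ; d = d ; m+d≡n = refl ; word = v ++ b ∷ q
    ; word≲u = ≲-++ ss ps full v≲s univ (∷-≲ q≲p)
    ; universal = Universal-++ univ (All.map (≲-letters (∷-≲ q≲p)) full)
    ; short = begin
        length (v ++ b ∷ q)                       ≡⟨ length-++ v ⟩
        length v + suc (length q)                 ≤⟨ +-mono-≤ short (s≤s q-short) ⟩
        m * h (suc d) + m + h d + suc (h (suc d)) ≡⟨ arith m (h (suc d)) (h d) ⟩
        suc m * h (suc d) + suc m + h d           ∎ }
    where
    open ≤-Reasoning
    arith : ∀ m x y → m * x + m + y + suc x ≡ suc m * x + suc m + y
    arith = solve-∀

  -- Leaving `h′` abstract lets one argument serve both the one-letter alphabet and the recursion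
  -- for `f`.
  compressible-∷ : ∀ {h′ : ℕ → ℕ} → (∀ m d → m * h (suc d) + m + h d ≤ h′ (m + d)) →
                   Compressible h′ (c ∷ L)
  compressible-∷ bound us n with archCompression n us
  ... | record { m = m ; d = d ; m+d≡n = refl ; word = v ; word≲u = v≲u ; short = short } =
    v , v≲u , ≤-trans short (bound m d)

-- The left side is the entry at index `m` of the maximum defining `f` at `m + d`, once the
-- truncated subtractions are evaluated to `suc d` and `d`.
f-bound : ∀ k m d → m * f (suc k) (suc d) + m + f (suc k) d ≤ f (suc (suc k)) (m + d)
f-bound k m d = subst₂ (λ x y → m * f (suc k) x + m + f (suc k) y ≤ f (suc (suc k)) (m + d))
  (trans (cong (_∸ m) (+-assoc m d 1)) (trans (m+n∸m≡n m (d + 1)) (+-comm d 1)))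
  (m+n∸m≡n m d)
  (All.lookup (xs≤max 0 _) (∈-map⁺ _ (∈-upTo⁺ (s≤s (m≤m+n m d)))))

compressible : DecidableEquality A → ∀ k (L : List A) → length L ≡ suc k → Compressible (f (suc k)) L
-- The value 0 for the empty alphabet turns the recursion for f into f 1 n = n.
compressible _≟_ zero (c ∷ []) _ = compressible-∷ _≟_ {h = λ _ → 0} compress-[] bound
  where
  compress-[] : ∀ {b} (i : b ∈ c ∷ []) → Compressible (λ _ → 0) ((c ∷ []) ─ i)
  compress-[] (here _) [] n = [] , ≲-refl , z≤n
  bound : ∀ m d → m * 0 + m + 0 ≤ m + d
  bound m d = begin
    m * 0 + m + 0 ≡⟨ arith m ⟩
    m             ≤⟨ m≤m+n m d ⟩
    m + d         ∎
    where
    open ≤-Reasoning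
    arith : ∀ m → m * 0 + m + 0 ≡ m
    arith = solve-∀
compressible _≟_ (suc k) (c ∷ L) len = compressible-∷ _≟_
  (λ i → compressible _≟_ k _ (suc-injective (trans (sym (length-removeAt′ (c ∷ L) (index i))) len)))
  (f-bound k)

theorem6 : ∀ {a : Level} {A : Set a} (k : ℕ) .{{_ : NonZero k}} → A ↔ Fin k →
    (u : List A) (n : ℕ) → ∃[ v ] (v ≲[ n ] u × length v ≤ f k n)
theorem6 (suc k) A↔Fin u n =
  compressible (via-injection (↔⇒↣ A↔Fin) _≟ᶠ_) k letters
    (trans (length-map from (allFin (suc k))) (length-tabulate (λ i → i)))
    (All.tabulate λ {x} _ → subst (_∈ letters) (strictlyInverseʳ x) (∈-map⁺ from (∈-allFin (to x)))) n
  where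
  open Inverse A↔Fin
  letters = map from (allFin (suc k))
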